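{- Let $K=\{e\in\omega:\varphi_e(e)\downarrow\}$ be the halting set. The relation $E^{\mathrm{ce}}_K$ is universal but not computably universal.
   Context: Fix a standard (acceptable) enumeration $(\varphi_e)_{e\in\omega}$ of the partial computable functions and let $W_e=\operatorname{dom}(\varphi_e)$. Write $e=^{\mathrm{ce}}e'$ iff $W_e=W_{e'}$. For $A\subseteq\omega$, define the equivalence relation $E^{\mathrm{ce}}_A$ on $\omega$ by: $i\mathrel{E^{\mathrm{ce}}_A}j$ iff either $W_i\subseteq A$ and $W_j\subseteq A$, or $W_i\not\subseteq A$ and $W_j\not\subseteq A$. An enumeration of a set $B$ is a surjection $\mu:\omega\to B$; $\mu[s]$ denotes the finite string $\mu(0),\dots,\mu(s-1)$. A learner is an arbitrary function $\mathbf{M}:\omega^{<\omega}\to\omega$. For an equivalence relation $E^{\mathrm{ce}}$ on $\omega$ extending $=^{\mathrm{ce}}$, a family $\mathfrak{K}$ of nonempty c.e. sets is $E^{\mathrm{ce}}$-learnable (respectively, computably $E^{\mathrm{ce}}$-learnable) if there is a learner $\mathbf{M}$ (respectively, a computable learner $\mathbf{M}$) such that for every $e$ with $W_e\in\mathfrak{K}$ and every enumeration $\mu$ of $W_e$ there is $i\in\omega$ with $i\mathrel{E^{\mathrm{ce}}}e$ and $\mathbf{M}(\mu[s])=i$ for all sufficiently large $s$; here $\mu$ is not required to be computable. $E^{\mathrm{ce}}$ is universal if every family of nonempty c.e. sets is $E^{\mathrm{ce}}$-learnable, and computably universal if every family of nonempty c.e. sets is computably $E^{\mathrm{ce}}$-learnable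 (equivalently, if $\{W_e:e\in\omega,\ W_e\neq\emptyset\}$ is computably $E^{\mathrm{ce}}$-learnable). -}

module Defs where

open import Axiom.ExcludedMiddle using (ExcludedMiddle)
open import Data.Empty using (⊥-elim)
open import Data.Fin.Base using (Fin)
open import Data.List.Base as List using (List; applyUpTo)
open import Data.Nat.Base using (ℕ; zero; suc; _*_; _^_; _<_; _≤_)
open import Data.Product.Base using (Σ; ∃-syntax; _×_; _,_)
open import Data.Sum.Base using (_⊎_; inj₁; inj₂)
open import Data.Vec.Base using (Vec; []; _∷_; lookup)
open import Data.Vec.Relation.Binary.Pointwise.Inductive using (Pointwise)
open import Function.Bundles using (_⇔_)
open import Level using (0ℓ)
open import Relation.Binary.Core using (Rel; REL)
open import Relation.Binary.Definitions using (_Respects_)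
open import Relation.Binary.Structures using (IsEquivalence)
open import Relation.Binary.PropositionalEquality.Core using (_≡_)
open import Relation.Nullary using (¬_; yes; no)
open import Relation.Unary using (Pred; _∈_; _⊆_; _⊈_; _≐_; Satisfiable)

-- Partial recursive functions (Kleene's μ-recursive schemes).

data PR : ℕ → Set where
  zer  : ∀ {n} → PR n
  succ : PR 1
  proj : ∀ {n} → Fin n → PR n
  comp : ∀ {m n} → PR m → Vec (PR n) m → PR n
  prec : ∀ {n} → PR n → PR (suc (suc n)) → PR (suc n)
  mu   : ∀ {n} → PR (suc n) → PR n

infix 4 _[_]↓_

-- p [ xs ]↓ y : the computation of p on xs halts with value y.
data _[_]↓_ : ∀ {n} → PR n → Vec ℕ n → ℕ → Set where
  zer↓  : ∀ {n} {xs : Vec ℕ n} → zer [ xs ]↓ 0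
  succ↓ : ∀ {x} → succ [ x ∷ [] ]↓ suc x
  proj↓ : ∀ {n} {xs : Vec ℕ n} (i : Fin n) → proj i [ xs ]↓ lookup xs i
  comp↓ : ∀ {m n} {f : PR m} {gs : Vec (PR n) m} {xs : Vec ℕ n} {ys : Vec ℕ m} {z} →
          Pointwise (λ g y → g [ xs ]↓ y) gs ys → f [ ys ]↓ z →
          comp f gs [ xs ]↓ z
  prec↓-zero : ∀ {n} {f : PR n} {g : PR (suc (suc n))} {xs : Vec ℕ n} {y} →
               f [ xs ]↓ y →
               prec f g [ zero ∷ xs ]↓ y
  prec↓-suc  : ∀ {n} {f : PR n} {g : PR (suc (suc n))} {xs : Vec ℕ n} {k y z} →
               prec f g [ k ∷ xs ]↓ y → g [ k ∷ y ∷ xs ]↓ z →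
               prec f g [ suc k ∷ xs ]↓ z
  mu↓ : ∀ {n} {f : PR (suc n)} {xs : Vec ℕ n} {y} →
        (∀ z → z < y → ∃[ w ] f [ z ∷ xs ]↓ suc w) → f [ y ∷ xs ]↓ 0 →
        mu f [ xs ]↓ y

-- A partial function is represented by its graph.
PartialComputable : ∀ {n} → REL (Vec ℕ n) ℕ 0ℓ → Set
PartialComputable {n} R = Σ (PR n) λ p → ∀ xs y → R xs y ⇔ p [ xs ]↓ y

Computable : (ℕ → ℕ) → Set
Computable f = Σ (PR 1) λ p → ∀ x → p [ x ∷ [] ]↓ f x

graph₁ : REL ℕ ℕ 0ℓ → REL (Vec ℕ 1) ℕ 0ℓ
graph₁ ψ (x ∷ []) y = ψ x y

graph₂ : (ℕ → REL ℕ ℕ 0ℓ) → REL (Vec ℕ 2) ℕ 0ℓ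
graph₂ ψ (e ∷ x ∷ []) y = ψ e x y

-- Acceptable enumerations in the sense of Rogers: the unary partial computable
-- functions are listed, with a partial computable universal function and a
-- computable s-m-n (parametrization) function.  φ e x y reads "φ_e(x)↓ = y".
record AcceptableEnumeration : Set₁ where
  field
    φ               : ℕ → REL ℕ ℕ 0ℓ
    universal       : PartialComputable (graph₂ φ)
    surjective      : ∀ (ψ : REL ℕ ℕ 0ℓ) → PartialComputable (graph₁ ψ) →
                      ∃[ e ] (∀ x y → φ e x y ⇔ ψ x y)
    parametrization : ∀ (ψ : ℕ → REL ℕ ℕ 0ℓ) → PartialComputable (graph₂ ψ) →
                      ∃[ s ] Computable s × (∀ e x y → φ (s e) x y ⇔ ψ e x y)

  W : ℕ → Pred ℕ 0ℓ
  W e x = ∃[ y ] φ e x y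

  K : Pred ℕ 0ℓ
  K e = e ∈ W e

  _=ᶜᵉ_ : Rel ℕ 0ℓ
  e =ᶜᵉ e′ = W e ≐ W e′

  Eᶜᵉ : Pred ℕ 0ℓ → Rel ℕ 0ℓ
  Eᶜᵉ A i j = (W i ⊆ A × W j ⊆ A) ⊎ (W i ⊈ A × W j ⊈ A)

  Eᶜᵉ-isEquivalence : ExcludedMiddle 0ℓ → ∀ A → IsEquivalence (Eᶜᵉ A)
  Eᶜᵉ-isEquivalence em A = record
    { refl  = λ {i} → refl′ i
    ; sym   = λ { (inj₁ (p , q)) → inj₁ (q , p) ; (inj₂ (p , q)) → inj₂ (q , p) }
    ; trans = λ { (inj₁ (p , _)) (inj₁ (_ , r)) → inj₁ (p , r)
                ; (inj₁ (_ , q)) (inj₂ (n , _)) → ⊥-elim (n q)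
                ; (inj₂ (_ , n)) (inj₁ (q , _)) → ⊥-elim (n q)
                ; (inj₂ (p , _)) (inj₂ (_ , r)) → inj₂ (p , r) }
    }
    where
    refl′ : ∀ i → Eᶜᵉ A i i
    refl′ i with em {W i ⊆ A}
    ... | yes p = inj₁ (p , p)
    ... | no  n = inj₂ (n , n)

  Eᶜᵉ-extends-=ᶜᵉ : ExcludedMiddle 0ℓ → ∀ A {i j} → i =ᶜᵉ j → Eᶜᵉ A i j
  Eᶜᵉ-extends-=ᶜᵉ em A {i} {j} (i⊆j , j⊆i) with em {W i ⊆ A}
  ... | yes p = inj₁ (p , λ x → p (j⊆i x))
  ... | no  n = inj₂ (n , λ q → n (λ x → q (i⊆j x)))

Learner : Set
Learner = List ℕ → ℕ

-- The bijection ω^{<ω} → ω sending the string a₀,…,aₖ to the number whose binary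
-- expansion, read from the least significant bit, is 0^{a₀} 1 0^{a₁} 1 … 0^{aₖ} 1.
code : List ℕ → ℕ
code List.[]      = 0
code (a List.∷ σ) = 2 ^ a * suc (2 * code σ)

ComputableLearner : Learner → Set
ComputableLearner M = Σ (PR 1) λ p → ∀ σ → p [ code σ ∷ [] ]↓ M σ

record IsEnumeration (μ : ℕ → ℕ) (B : Pred ℕ 0ℓ) : Set where
  field
    into : ∀ n → μ n ∈ B
    onto : ∀ {x} → x ∈ B → ∃[ n ] μ n ≡ x

module _ (𝓔 : AcceptableEnumeration) where
  open AcceptableEnumeration 𝓔

  -- Sets of numbers are predicates, taken up to extensional equality ≐; hence the
  -- requirement that membership in a family respects ≐.
  record Family : Set₁ where
    field
      Member   : Pred (Pred ℕ 0ℓ) 0ℓ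
      respects : Member Respects _≐_
      ce       : ∀ {B} → Member B → ∃[ e ] B ≐ W e
      nonempty : ∀ {B} → Member B → Satisfiable B

  Learns : Rel ℕ 0ℓ → Learner → Family → Set
  Learns E M 𝔎 =
    ∀ e → Family.Member 𝔎 (W e) →
    ∀ (μ : ℕ → ℕ) → IsEnumeration μ (W e) →
    ∃[ i ] E i e × (∃[ N ] ∀ s → N ≤ s → M (applyUpTo μ s) ≡ i)

  Learnable : Rel ℕ 0ℓ → Family → Set
  Learnable E 𝔎 = ∃[ M ] Learns E M 𝔎

  ComputablyLearnable : Rel ℕ 0ℓ → Family → Set
  ComputablyLearnable E 𝔎 = ∃[ M ] ComputableLearner M × Learns E M 𝔎

  Universal : Rel ℕ 0ℓ → Set₁
  Universal E = ∀ 𝔎 → Learnable E 𝔎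

  ComputablyUniversal : Rel ℕ 0ℓ → Set₁
  ComputablyUniversal E = ∀ 𝔎 → ComputablyLearnable E 𝔎

{-# OPTIONS --safe #-}
module Submission where

open import Defs
open import Axiom.ExcludedMiddle using (ExcludedMiddle)
open import Axiom.DoubleNegationElimination using (em⇒dne)
open import Data.Empty using (⊥; ⊥-elim)
open import Data.Fin.Base using (zero; suc)
open import Data.List.Base using (List; []; _∷_; _++_; applyUpTo; length)
open import Data.List.Membership.Propositional using () renaming (_∈_ to _∈ₗ_)
open import Data.List.Membership.Propositional.Properties
  using (∈-applyUpTo⁺; ∈-applyUpTo⁻; ∈-++⁺ʳ)
open import Data.List.Properties using (++-assoc; ++-identityʳ; length-++)
open import Data.List.Relation.Unary.All as All using (All; []; _∷_)
open import Data.List.Relation.Unary.All.Properties as All using ()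
open import Data.List.Relation.Unary.Any using (here; there)
open import Data.Nat.Base
  using (ℕ; zero; suc; _+_; _*_; _^_; _∸_; _≤_; _<_; z≤n; s≤s; z<s; s<s)
open import Data.Nat.Properties
open import Data.Product.Base using (Σ; ∃-syntax; _×_; _,_; proj₁; proj₂)
open import Data.Sum.Base using (inj₁; inj₂)
open import Data.Vec.Base using (Vec; []; _∷_)
open import Data.Vec.Relation.Binary.Pointwise.Inductive using (Pointwise; []; _∷_)
open import Function.Base using (_∘_; const)
open import Function.Bundles using (_⇔_; mk⇔; Equivalence)
open import Level using (0ℓ)
open import Relation.Binary.Definitions using (tri<; tri≈; tri>)
open import Relation.Binary.PropositionalEquality
  using (_≡_; _≢_; refl; sym; trans; cong; cong₂; subst; module ≡-Reasoning)
open import Relation.Nullary using (¬_; yes; no; contradiction)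
open import Relation.Unary using (Pred; _∈_; _∉_; _⊆_; _⊈_; _≐_)

-- Classically, two indices suffice for a learner that may ask whether the string seen
-- so far lies in K.  Conversely, a computable learner M that succeeds on K has a
-- locking string σ for K: M(στ) = M(σ) = i for all strings τ in K, and W_i ⊆ K.
-- The search for an s with M(σ xˢ) ≠ i is a partial computable function of x; let a be
-- one of its indices, so that a ∈ K iff M(σ aˢ) ≠ i for some s.  If a ∈ K, this
-- contradicts locking; if a ∉ K, then M settles on i along the enumeration σ a a a … of a
-- finite set not contained in K, although W_i ⊆ K.

-- Partial recursive functions

↓-functional : ∀ {n} {p : PR n} {xs y z} → p [ xs ]↓ y → p [ xs ]↓ z → y ≡ z
↓-functional* : ∀ {m n} {gs : Vec (PR n) m} {xs ys zs} →
  Pointwise (λ g y → g [ xs ]↓ y) gs ys → Pointwise (λ g z → g [ xs ]↓ z) gs zs → ys ≡ zs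
↓-functional zer↓ zer↓ = refl
↓-functional succ↓ succ↓ = refl
↓-functional (proj↓ i) (proj↓ .i) = refl
↓-functional (comp↓ gs f) (comp↓ gs′ f′) with refl ← ↓-functional* gs gs′ = ↓-functional f f′
↓-functional (prec↓-zero f) (prec↓-zero f′) = ↓-functional f f′
↓-functional (prec↓-suc r g) (prec↓-suc r′ g′) with refl ← ↓-functional r r′ = ↓-functional g g′
-- If the two results differed, then at the smaller one the same program would yield both 0 and a
-- successor.
↓-functional (mu↓ {y = y} below f) (mu↓ {y = z} below′ f′) with <-cmp y z
... | tri≈ _ y≡z _ = y≡z
... | tri< y<z _ _ = contradiction (↓-functional f (proj₂ (below′ y y<z))) λ ()
... | tri> _ _ z<y = contradiction (↓-functional (proj₂ (below z z<y)) f′) λ ()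
↓-functional* [] [] = refl
↓-functional* (g ∷ gs) (g′ ∷ gs′) = cong₂ _∷_ (↓-functional g g′) (↓-functional* gs gs′)

-- `mu↓` demands successor values at all earlier arguments, so a given zero of `t` has to be traded
-- for the least one.
least-zero : ∀ (t : ℕ → ℕ) n → t n ≡ 0 →
  ∃[ y ] t y ≡ 0 × (∀ z → z < y → ∃[ w ] t z ≡ suc w)
least-zero t n tn≡0 with t 0 in eq
least-zero t n tn≡0 | zero = 0 , eq , λ _ ()
least-zero t zero tn≡0 | suc w = contradiction (trans (sym eq) tn≡0) λ ()
least-zero t (suc n) tn≡0 | suc w with least-zero (t ∘ suc) n tn≡0
... | y , ty≡0 , below = suc y , ty≡0 , λ { zero _ → w , eq ; (suc z) (s<s z<y) → below z z<y }

module _ {n} {p : PR (suc n)} {xs : Vec ℕ n} {t : ℕ → ℕ} (p↓ : ∀ z → p [ z ∷ xs ]↓ t z) where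

  mu-halts : ∀ z → t z ≡ 0 → ∃[ y ] mu p [ xs ]↓ y
  mu-halts z tz≡0 with least-zero t z tz≡0
  ... | y , ty≡0 , below =
    y , mu↓ (λ z z<y → let w , eq = below z z<y in w , subst (p [ _ ]↓_) eq (p↓ z))
            (subst (p [ _ ]↓_) ty≡0 (p↓ y))

  mu-zero : ∀ {y} → mu p [ xs ]↓ y → t y ≡ 0
  mu-zero (mu↓ _ p↓0) = ↓-functional (p↓ _) p↓0

constant : ∀ {n} → ℕ → PR n
constant zero    = zer
constant (suc k) = comp succ (constant k ∷ [])

constant↓ : ∀ {n} k {xs : Vec ℕ n} → constant k [ xs ]↓ k
constant↓ zero    = zer↓
constant↓ (suc k) = comp↓ (constant↓ k ∷ []) succ↓

-- The Kronecker delta. Inequality gives 0, the value at which `mu` stops, so a search through this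
-- test halts where a learner departs from a fixed conjecture.
δ : ℕ → ℕ → ℕ
δ zero    zero    = 1
δ zero    (suc _) = 0
δ (suc _) zero    = 0
δ (suc i) (suc j) = δ i j

δ-refl : ∀ i → δ i i ≡ 1
δ-refl zero    = refl
δ-refl (suc i) = δ-refl i

δ-≢ : ∀ i j → j ≢ i → δ i j ≡ 0
δ-≢ zero    zero    j≢i = contradiction refl j≢i
δ-≢ zero    (suc j) _   = refl
δ-≢ (suc i) zero    _   = refl
δ-≢ (suc i) (suc j) j≢i = δ-≢ i j (j≢i ∘ cong suc)

-- The first argument is fixed outside the program, and `prec` serves as a mere case distinction:
-- its step never reads the recursive value.
kronecker : ℕ → PR 1
kronecker zero    = prec (constant 1) zer
kronecker (suc i) = prec zer (comp (kronecker i) (proj zero ∷ []))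

kronecker↓ : ∀ i j → kronecker i [ j ∷ [] ]↓ δ i j
kronecker↓ zero    zero    = prec↓-zero (constant↓ 1)
kronecker↓ zero    (suc j) = prec↓-suc (kronecker↓ zero j) zer↓
kronecker↓ (suc i) zero    = prec↓-zero zer↓
kronecker↓ (suc i) (suc j) =
  prec↓-suc (kronecker↓ (suc i) j) (comp↓ (proj↓ zero ∷ []) (kronecker↓ i j))

outside : List ℕ → ℕ → ℕ
outside []      x = 1
outside (b ∷ l) x with δ b x
... | zero  = outside l x
... | suc _ = 0

unless : PR 2
unless = prec (proj zero) zer

avoids : List ℕ → PR 1
avoids []      = constant 1
avoids (b ∷ l) = comp unless (kronecker b ∷ avoids l ∷ [])

unless-suc↓ : ∀ k {y} → unless [ suc k ∷ y ∷ [] ]↓ 0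
unless-suc↓ zero    = prec↓-suc (prec↓-zero (proj↓ zero)) zer↓
unless-suc↓ (suc k) = prec↓-suc (unless-suc↓ k) zer↓

avoids↓ : ∀ l x → avoids l [ x ∷ [] ]↓ outside l x
avoids↓ []      x = constant↓ 1
avoids↓ (b ∷ l) x with δ b x | kronecker↓ b x
... | zero  | δ↓ = comp↓ (δ↓ ∷ avoids↓ l x ∷ []) (prec↓-zero (proj↓ zero))
... | suc k | δ↓ = comp↓ (δ↓ ∷ avoids↓ l x ∷ []) (unless-suc↓ k)

outside-∈ : ∀ {l x} → x ∈ₗ l → outside l x ≡ 0
outside-∈ {b ∷ l} (here refl) rewrite δ-refl b = refl
outside-∈ {b ∷ l} {x} (there x∈l) with δ b x
... | zero  = outside-∈ x∈l
... | suc _ = refl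

∈-outside : ∀ l {x} → outside l x ≡ 0 → x ∈ₗ l
∈-outside (b ∷ l) {x} eq with x ≟ b
... | yes x≡b = here x≡b
... | no  x≢b rewrite δ-≢ b x x≢b = there (∈-outside l eq)

-- The tested value does not depend on the search variable, so the search stops at once or never.
finiteDomain : List ℕ → PR 1
finiteDomain l = mu (comp (avoids l) (proj (suc zero) ∷ []))

module _ (l : List ℕ) {x : ℕ} where

  private
    search↓ : ∀ z → comp (avoids l) (proj (suc zero) ∷ []) [ z ∷ x ∷ [] ]↓ outside l x
    search↓ z = comp↓ (proj↓ (suc zero) ∷ []) (avoids↓ l x)

  finiteDomain-halts : x ∈ₗ l → ∃[ y ] finiteDomain l [ x ∷ [] ]↓ y
  finiteDomain-halts x∈l = mu-halts search↓ 0 (outside-∈ x∈l)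

  finiteDomain-∈ : ∀ {y} → finiteDomain l [ x ∷ [] ]↓ y → x ∈ₗ l
  finiteDomain-∈ = ∈-outside l ∘ mu-zero search↓

-- Codes of strings

double : PR 1
double = prec zer (comp succ (comp succ (proj (suc zero) ∷ []) ∷ []))

double↓ : ∀ x → double [ x ∷ [] ]↓ 2 * x
double↓ zero    = prec↓-zero zer↓
double↓ (suc x) = subst (double [ suc x ∷ [] ]↓_) (sym (*-suc 2 x))
  (prec↓-suc (double↓ x) (comp↓ (comp↓ (proj↓ (suc zero) ∷ []) succ↓ ∷ []) succ↓))

-- Putting b in front of the string with code c amounts to doubling 2c + 1 exactly b times.
cons : PR 2
cons = prec (comp succ (double ∷ [])) (comp double (proj (suc zero) ∷ []))

cons↓ : ∀ b c → cons [ b ∷ c ∷ [] ]↓ 2 ^ b * suc (2 * c)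
cons↓ zero    c = subst (cons [ 0 ∷ c ∷ [] ]↓_) (sym (*-identityˡ _))
  (prec↓-zero (comp↓ (double↓ c ∷ []) succ↓))
cons↓ (suc b) c = subst (cons [ suc b ∷ c ∷ [] ]↓_) (sym (*-assoc 2 (2 ^ b) _))
  (prec↓-suc (cons↓ b c) (comp↓ (proj↓ (suc zero) ∷ []) (double↓ _)))

-- The letters of σ are built into the program. The repetition count comes first: `prec` recurses on
-- it, and `mu` searches over it in `findChange`.
_then-repeat : List ℕ → PR 2
[]      then-repeat = prec zer (comp cons (proj (suc (suc zero)) ∷ proj (suc zero) ∷ []))
(b ∷ σ) then-repeat = comp cons (constant b ∷ σ then-repeat ∷ [])

then-repeat↓ : ∀ σ s x → (σ then-repeat) [ s ∷ x ∷ [] ]↓ code (σ ++ applyUpTo (const x) s)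
then-repeat↓ []      zero    x = prec↓-zero zer↓
then-repeat↓ []      (suc s) x =
  prec↓-suc (then-repeat↓ [] s x)
            (comp↓ (proj↓ (suc (suc zero)) ∷ proj↓ (suc zero) ∷ []) (cons↓ x _))
then-repeat↓ (b ∷ σ) s       x = comp↓ (constant↓ b ∷ then-repeat↓ σ s x ∷ []) (cons↓ b _)

-- The search of the diagonal argument: when `q` computes the learner M, it halts on x exactly if
-- M(σ xˢ) ≠ i for some s.
findChange : PR 1 → List ℕ → ℕ → PR 1
findChange q σ i = mu (comp (kronecker i) (comp q (σ then-repeat ∷ []) ∷ []))

module _ {q : PR 1} {M : Learner} (q↓ : ∀ τ → q [ code τ ∷ [] ]↓ M τ) (σ : List ℕ) (i x : ℕ) where

  private
    test↓ : ∀ s → comp (kronecker i) (comp q (σ then-repeat ∷ []) ∷ []) [ s ∷ x ∷ [] ]↓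
                  δ i (M (σ ++ applyUpTo (const x) s))
    test↓ s = comp↓ (comp↓ (then-repeat↓ σ s x ∷ []) (q↓ _) ∷ []) (kronecker↓ i _)

  findChange-halts : ∀ s → M (σ ++ applyUpTo (const x) s) ≢ i →
    ∃[ y ] findChange q σ i [ x ∷ [] ]↓ y
  findChange-halts s M≢i = mu-halts test↓ s (δ-≢ i _ M≢i)

  findChange-change : ∀ {y} → findChange q σ i [ x ∷ [] ]↓ y →
    M (σ ++ applyUpTo (const x) y) ≢ i
  findChange-change p↓ M≡i
    with () ← trans (sym (trans (cong (δ i) M≡i) (δ-refl i))) (mu-zero test↓ p↓)

-- Locking strings

prepend : List ℕ → (ℕ → ℕ) → ℕ → ℕ
prepend []      f t       = f t
prepend (b ∷ σ) f zero    = b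
prepend (b ∷ σ) f (suc t) = prepend σ f t

applyUpTo-cong : ∀ {f g : ℕ → ℕ} n → (∀ {t} → t < n → f t ≡ g t) → applyUpTo f n ≡ applyUpTo g n
applyUpTo-cong zero    _   = refl
applyUpTo-cong (suc n) f≗g = cong₂ _∷_ (f≗g z<s) (applyUpTo-cong n (f≗g ∘ s<s))

applyUpTo-prepend : ∀ σ f s → applyUpTo (prepend σ f) (length σ + s) ≡ σ ++ applyUpTo f s
applyUpTo-prepend []      f s = refl
applyUpTo-prepend (b ∷ σ) f s = cong (b ∷_) (applyUpTo-prepend σ f s)

prepend-++ : ∀ σ τ f {t} → t < length σ → prepend (σ ++ τ) f t ≡ prepend σ f t
prepend-++ (b ∷ σ) τ f {zero}  _         = refl
prepend-++ (b ∷ σ) τ f {suc t} (s<s t<σ) = prepend-++ σ τ f t<σ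

prepend-length+ : ∀ σ f t → prepend σ f (length σ + t) ≡ f t
prepend-length+ []      f t = refl
prepend-length+ (b ∷ σ) f t = prepend-length+ σ f t

prepend-All : ∀ {B : Pred ℕ 0ℓ} {σ f} → All B σ → (∀ t → f t ∈ B) → ∀ t → prepend σ f t ∈ B
prepend-All []       f∈B t       = f∈B t
prepend-All (b ∷ bs) f∈B zero    = b
prepend-All (b ∷ bs) f∈B (suc t) = prepend-All bs f∈B t

prepend-isEnumeration : ∀ {B : Pred ℕ 0ℓ} {σ f} → All B σ → IsEnumeration f B →
  IsEnumeration (prepend σ f) B
prepend-isEnumeration {σ = σ} {f} σ∈B f-enum = record
  { into = prepend-All σ∈B into
  ; onto = λ x∈B → let n , eq = onto x∈B in length σ + n , trans (prepend-length+ σ f n) eq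
  }
  where open IsEnumeration f-enum

Converges : Learner → (ℕ → ℕ) → Set
Converges M μ = ∃[ i ] ∃[ N ] ∀ s → N ≤ s → M (applyUpTo μ s) ≡ i

-- Only stability of the conjecture is asked. Its correctness is derived later, from the success of
-- the learner.
Locking : Learner → Pred ℕ 0ℓ → List ℕ → Set
Locking M B σ = ∀ τ → All B τ → M (σ ++ τ) ≡ M σ

module _ {M : Learner} {B : Pred ℕ 0ℓ} {f : ℕ → ℕ} (f-enum : IsEnumeration f B)
         (change : ∀ σ → All B σ → ∃[ τ ] All B τ × M (σ ++ τ) ≢ M σ) where

  open IsEnumeration f-enum

  private
    detour : Σ (List ℕ) (All B) → Σ (List ℕ) (All B)
    detour (σ , σ∈B) = let τ , τ∈B , _ = change σ σ∈B in σ ++ τ , All.++⁺ σ∈B τ∈B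

    -- Each stage appends first a string on which M changes its mind, then the next value of `f`.
    -- The former spoils convergence in the limit, the latter makes the limit exhaust B.
    chain : ℕ → Σ (List ℕ) (All B)
    chain zero    = [] , []
    chain (suc n) = let σ , σ∈B = detour (chain n) in σ ++ f n ∷ [] , All.++⁺ σ∈B (into n ∷ [])

    detoured : ℕ → List ℕ
    detoured n = proj₁ (detour (chain n))

    segment : ℕ → List ℕ
    segment = proj₁ ∘ chain

    segment-extends : ∀ m d → ∃[ ρ ] segment (d + m) ≡ segment m ++ ρ
    segment-extends m zero    = [] , sym (++-identityʳ _)
    segment-extends m (suc d) with segment-extends m d
    ... | ρ , eq = _ , (begin
      (segment (d + m) ++ τ) ++ f (d + m) ∷ []   ≡⟨ ++-assoc (segment (d + m)) τ _ ⟩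
      segment (d + m) ++ τ ++ f (d + m) ∷ []     ≡⟨ cong (_++ τ ++ f (d + m) ∷ []) eq ⟩
      (segment m ++ ρ) ++ τ ++ f (d + m) ∷ []    ≡⟨ ++-assoc (segment m) ρ _ ⟩
      segment m ++ ρ ++ τ ++ f (d + m) ∷ []      ∎)
      where
      open ≡-Reasoning
      τ = proj₁ (change (segment (d + m)) (proj₂ (chain (d + m))))

    n≤length-segment : ∀ n → n ≤ length (segment n)
    n≤length-segment zero    = z≤n
    n≤length-segment (suc n) = begin
      suc n                                  ≤⟨ s≤s (n≤length-segment n) ⟩
      suc (length (segment n))               ≤⟨ s≤s (m≤m+n _ _) ⟩
      suc (length (segment n) + length τ)    ≡⟨ cong suc (length-++ (segment n)) ⟨
      suc (length (detoured n))                ≡⟨ +-comm 1 _ ⟩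
      length (detoured n) + 1                  ≡⟨ length-++ (detoured n) ⟨
      length (segment (suc n))               ∎
      where
      open ≤-Reasoning
      τ = proj₁ (change (segment n) (proj₂ (chain n)))

    -- Stage `suc t` has length at least `suc t`, so position t lies inside it and the tail `f`
    -- supplied to `prepend` is never read.
    limit : ℕ → ℕ
    limit t = prepend (segment (suc t)) f t

    segment-≤ : ∀ {m n t} → m ≤ n → t < length (segment m) →
      prepend (segment n) f t ≡ prepend (segment m) f t
    segment-≤ {m} {n} {t} m≤n t<m with segment-extends m (n ∸ m)
    ... | ρ , eq = begin
      prepend (segment n) f t             ≡⟨ cong (λ k → prepend (segment k) f t) (m∸n+n≡m m≤n) ⟨
      prepend (segment (n ∸ m + m)) f t   ≡⟨ cong (λ σ → prepend σ f t) eq ⟩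
      prepend (segment m ++ ρ) f t        ≡⟨ prepend-++ (segment m) ρ f t<m ⟩
      prepend (segment m) f t             ∎
      where open ≡-Reasoning

    limit-segment : ∀ n {t} → t < length (segment n) → limit t ≡ prepend (segment n) f t
    limit-segment n {t} t<n with ≤-total n (suc t)
    ... | inj₁ n≤t = segment-≤ n≤t t<n
    ... | inj₂ 1+t≤n = sym (segment-≤ 1+t≤n (n≤length-segment (suc t)))

    -- Stated for every prefix of a stage, since it has to cover both `segment n` and the
    -- intermediate string `detoured n`, a prefix of `segment (suc n)`.
    applyUpTo-limit : ∀ n σ ρ → segment n ≡ σ ++ ρ → applyUpTo limit (length σ) ≡ σ
    applyUpTo-limit n σ ρ eq = begin
      applyUpTo limit (length σ)             ≡⟨ applyUpTo-cong (length σ) agree ⟩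
      applyUpTo (prepend σ f) (length σ)     ≡⟨ cong (applyUpTo (prepend σ f)) (+-identityʳ _) ⟨
      applyUpTo (prepend σ f) (length σ + 0) ≡⟨ applyUpTo-prepend σ f 0 ⟩
      σ ++ []                                ≡⟨ ++-identityʳ σ ⟩
      σ                                      ∎
      where
      open ≡-Reasoning
      length≤ : length σ ≤ length (segment n)
      length≤ = ≤-trans (m≤m+n _ _)
        (≤-reflexive (sym (trans (cong length eq) (length-++ σ))))
      agree : ∀ {t} → t < length σ → limit t ≡ prepend σ f t
      agree {t} t<σ = trans (limit-segment n (≤-trans t<σ length≤))
        (trans (cong (λ ρ → prepend ρ f t) eq) (prepend-++ σ ρ f t<σ))

    limit-isEnumeration : IsEnumeration limit B
    limit-isEnumeration = record
      { into = λ t → prepend-All (proj₂ (chain (suc t))) into t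
      ; onto = λ x∈B → let n , fn≡x = onto x∈B in hit n fn≡x
      }
      where
      hit : ∀ {x} n → f n ≡ x → ∃[ t ] limit t ≡ x
      -- `f n` is the last letter of `segment (suc n)`, which is an initial segment of `limit`.
      hit n refl with t , _ , eq ← ∈-applyUpTo⁻ limit
        (subst (f n ∈ₗ_) (sym (applyUpTo-limit (suc n) (segment (suc n)) [] (sym (++-identityʳ _))))
               (∈-++⁺ʳ (detoured n) (here refl))) = t , sym eq

    -- Both `segment N` and `detoured N` are initial segments of `limit` of length at least N, yet M
    -- differs on them.
    ¬limit-converges : ¬ Converges M limit
    ¬limit-converges (i , N , M≡i) = proj₂ (proj₂ (change (segment N) (proj₂ (chain N))))
      (trans (value (suc N) (detoured N) (f N ∷ []) refl N≤detoured)
             (sym (value N (segment N) [] (sym (++-identityʳ _)) N≤)))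
      where
      N≤ : N ≤ length (segment N)
      N≤ = n≤length-segment N
      N≤detoured : N ≤ length (detoured N)
      N≤detoured = ≤-trans N≤ (≤-trans (m≤m+n _ _) (≤-reflexive (sym (length-++ (segment N)))))
      value : ∀ n σ ρ → segment n ≡ σ ++ ρ → N ≤ length σ → M σ ≡ i
      value n σ ρ eq N≤σ = trans (cong M (sym (applyUpTo-limit n σ ρ eq))) (M≡i (length σ) N≤σ)

  divergent-enumeration : ∃[ μ ] IsEnumeration μ B × ¬ Converges M μ
  divergent-enumeration = limit , limit-isEnumeration , ¬limit-converges

-- If no string locks, excluded middle extracts a mind-changing extension within B from every string
-- over B, and `divergent-enumeration` then refutes convergence.
locking-string : ExcludedMiddle 0ℓ → ∀ {M B f} → IsEnumeration f B →
  (∀ μ → IsEnumeration μ B → Converges M μ) → ∃[ σ ] All B σ × Locking M B σ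
locking-string em {M} {B} f-enum converges with em {∃[ σ ] All B σ × Locking M B σ}
... | yes locked = locked
... | no ¬locked =
  let μ , μ-enum , ¬conv = divergent-enumeration f-enum change
  in contradiction (converges μ μ-enum) ¬conv
  where
  dne = em⇒dne em
  change : ∀ σ → All B σ → ∃[ τ ] All B τ × M (σ ++ τ) ≢ M σ
  change σ σ∈B = dne λ ¬change → ¬locked
    (σ , σ∈B , λ τ τ∈B → dne λ M≢ → ¬change (τ , τ∈B , M≢))

-- The identity on B, with everything else sent to b. Deciding membership classically is harmless,
-- as learners face arbitrary enumerations.
enumeration : ExcludedMiddle 0ℓ → ∀ {B : Pred ℕ 0ℓ} {b} → b ∈ B → ∃[ f ] IsEnumeration f B
enumeration em {B} {b} b∈B = f , record { into = f∈B ; onto = λ {x} x∈B → x , f-fixes x∈B }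
  where
  f : ℕ → ℕ
  f x with em {x ∈ B}
  ... | yes _ = x
  ... | no  _ = b
  f∈B : ∀ x → f x ∈ B
  f∈B x with em {x ∈ B}
  ... | yes x∈B = x∈B
  ... | no  _   = b∈B
  f-fixes : ∀ {x} → x ∈ B → f x ≡ x
  f-fixes {x} x∈B with em {x ∈ B}
  ... | yes _  = refl
  ... | no x∉B = contradiction x∈B x∉B

-- The relation `Eᶜᵉ K`: learning with and without computability

module _ (𝓔 : AcceptableEnumeration) where
  open AcceptableEnumeration 𝓔
  open Equivalence using (to; from)

  allNonempty : Family 𝓔
  allNonempty = record
    { Member   = λ B → (∃[ e ] B ≐ W e) × (∃[ x ] x ∈ B)
    ; respects = λ { (B⊆C , C⊆B) ((e , B⊆W , W⊆B) , x , x∈B) →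
                     (e , (λ h → B⊆W (C⊆B h)) , (λ h → B⊆C (W⊆B h))) , x , B⊆C x∈B }
    ; ce       = proj₁
    ; nonempty = proj₂
    }

  domain-index : (p : PR 1) → ∃[ e ] W e ≐ λ x → ∃[ y ] p [ x ∷ [] ]↓ y
  domain-index p =
    let e , φe = surjective (λ x y → p [ x ∷ [] ]↓ y) (p , λ { (x ∷ []) y → mk⇔ (λ h → h) (λ h → h) })
    in e , (λ { (y , h) → y , to (φe _ y) h }) , (λ { (y , h) → y , from (φe _ y) h })

  finite-index : ∀ l → ∃[ e ] W e ≐ (_∈ₗ l)
  finite-index l =
    let e , ⊆dom , dom⊆ = domain-index (finiteDomain l)
    in e , (λ h → finiteDomain-∈ l (proj₂ (⊆dom h))) , (λ h → dom⊆ (finiteDomain-halts l h))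

  -- K is the domain of the universal program run on the diagonal.
  K-index : ∃[ k ] W k ≐ K
  K-index =
    let u , φ⇔u = universal
        k , ⊆dom , dom⊆ = domain-index (comp u (proj zero ∷ proj zero ∷ []))
    in k , (λ h → diagonal (φ⇔u _ _) (proj₂ (⊆dom h)))
         , (λ { (y , h) → dom⊆ (y , comp↓ (proj↓ zero ∷ proj↓ zero ∷ []) (to (φ⇔u _ y) h)) })
    where
    diagonal : ∀ {u x y} → φ x x y ⇔ u [ x ∷ x ∷ [] ]↓ y →
      comp u (proj zero ∷ proj zero ∷ []) [ x ∷ [] ]↓ y → x ∈ K
    diagonal φ⇔u (comp↓ (proj↓ _ ∷ proj↓ _ ∷ []) u↓) = _ , from φ⇔u u↓

  -- Any index of a total function lies in K.
  K-satisfiable : ∃[ e ] e ∈ K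
  K-satisfiable = let e , _ , dom⊆ = domain-index zer in e , dom⊆ (0 , zer↓)

  -- Along an enumeration the conjecture changes at most once, when the first element outside K
  -- shows up.
  universal-K : ExcludedMiddle 0ℓ → Universal 𝓔 (Eᶜᵉ K)
  universal-K em 𝔎 = M , learns
    where
    e₀ = proj₁ (finite-index [])
    W₀-empty : ∀ {x} → x ∉ W e₀
    W₀-empty h with () ← proj₁ (proj₂ (finite-index [])) h
    -- As `W e₀` is empty, `e₀` is not in K, so its singleton is a c.e. set not contained in K.
    e₁ = proj₁ (finite-index (e₀ ∷ []))
    W₁⊈K : W e₁ ⊈ K
    W₁⊈K W₁⊆K = W₀-empty (W₁⊆K (proj₂ (proj₂ (finite-index (e₀ ∷ []))) (here refl)))

    M : Learner
    M σ with em {All K σ}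
    ... | yes _ = e₀
    ... | no  _ = e₁

    M-yes : ∀ {σ} → All K σ → M σ ≡ e₀
    M-yes {σ} σ∈K with em {All K σ}
    ... | yes _  = refl
    ... | no σ∉K = contradiction σ∈K σ∉K

    M-no : ∀ {σ} → ¬ All K σ → M σ ≡ e₁
    M-no {σ} σ∉K with em {All K σ}
    ... | yes σ∈K = contradiction σ∈K σ∉K
    ... | no _    = refl

    learns : Learns 𝓔 (Eᶜᵉ K) M 𝔎
    learns e _ μ μ-enum with em {W e ⊆ K}
    ... | yes W⊆K = e₀ , inj₁ (⊥-elim ∘ W₀-empty , W⊆K) ,
      0 , λ s _ → M-yes (All.applyUpTo⁺₂ μ s (W⊆K ∘ IsEnumeration.into μ-enum))
    ... | no W⊈K =
      let x , x∈W , x∉K = witness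
          n , μn≡x = IsEnumeration.onto μ-enum x∈W
      -- The witness μ n is visible only in strings of length greater than n, hence the bound
      -- `suc n`.
      in e₁ , inj₂ (W₁⊈K , W⊈K) , suc n , λ s n<s → M-no λ all∈K →
           x∉K (subst K μn≡x (All.lookup all∈K (∈-applyUpTo⁺ μ n<s)))
      where
      dne = em⇒dne em
      witness : ∃[ x ] x ∈ W e × x ∉ K
      witness = dne λ none → W⊈K λ {x} x∈W → dne λ x∉K → none (x , x∈W , x∉K)

  module _ {M : Learner} (M-computable : ComputableLearner M)
           (learns : Learns 𝓔 (Eᶜᵉ K) M allNonempty) where

    -- A conjecture held constantly after σ must be the limit conjecture, hence correct. It is
    -- applied to an enumeration of K after σ and to σ a a a ....
    eventual-value-correct : ∀ {e x} σ f {i} → x ∈ W e → IsEnumeration (prepend σ f) (W e) →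
      (∀ s → M (σ ++ applyUpTo f s) ≡ i) → Eᶜᵉ K i e
    eventual-value-correct {e} {x} σ f {i} x∈W μ-enum M≡i =
      let j , jEe , N , M≡j =
            learns e ((e , (λ h → h) , (λ h → h)) , x , x∈W) (prepend σ f) μ-enum
          -- Length `length σ + N` is past both σ and the convergence bound N, so the two values can
          -- be compared there.
          j≡i = trans (sym (M≡j (length σ + N) (m≤n+m N _)))
                      (trans (cong M (applyUpTo-prepend σ f N)) (M≡i N))
      in subst (λ k → Eᶜᵉ K k e) j≡i jEe

    not-computably-learned : ExcludedMiddle 0ℓ → ⊥
    not-computably-learned em = a∉K a∈K
      where
      k = proj₁ K-index
      Wk⊆K : W k ⊆ K
      Wk⊆K = proj₁ (proj₂ K-index)
      K⊆Wk : K ⊆ W k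
      K⊆Wk = proj₂ (proj₂ K-index)
      b∈Wk = K⊆Wk (proj₂ K-satisfiable)

      enum = enumeration em b∈Wk
      f = proj₁ enum

      locked = locking-string em {M} (proj₂ enum) λ μ μ-enum →
        let j , _ , conv = learns k ((k , (λ h → h) , (λ h → h)) , _ , b∈Wk) μ μ-enum in j , conv
      σ = proj₁ locked
      σ∈Wk = proj₁ (proj₂ locked)
      σ-locks = proj₂ (proj₂ locked)
      i = M σ

      -- Locking keeps the value i along σ followed by `f`, an enumeration of `W k`. Since `W k` is
      -- contained in K, so is `W i`.
      Wi⊆K : W i ⊆ K
      Wi⊆K with eventual-value-correct σ f b∈Wk (prepend-isEnumeration σ∈Wk (proj₂ enum))
                  (λ s → σ-locks _ (All.applyUpTo⁺₂ f s (IsEnumeration.into (proj₂ enum))))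
      ... | inj₁ (Wi⊆K , _) = Wi⊆K
      ... | inj₂ (_ , Wk⊈K) = ⊥-elim (Wk⊈K Wk⊆K)

      -- Self-reference comes from K itself: `a ∈ K` unfolds to `a ∈ W a`, which says that the
      -- search halts on its own index.
      change-index = domain-index (findChange (proj₁ M-computable) σ i)
      a = proj₁ change-index

      a∉K : a ∉ K
      a∉K a∈K =
        let s , p↓ = proj₁ (proj₂ change-index) a∈K
        in findChange-change (proj₂ M-computable) σ i a p↓
             (σ-locks _ (All.applyUpTo⁺₂ _ s (λ _ → K⊆Wk a∈K)))

      -- The letters of σ are included so that σ a a a ... enumerates `W e`.
      finite = finite-index (a ∷ σ)
      e = proj₁ finite
      ∈⇒∈We : ∀ {x} → x ∈ₗ a ∷ σ → x ∈ W e
      ∈⇒∈We = proj₂ (proj₂ finite)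

      σa-enum : IsEnumeration (prepend σ (const a)) (W e)
      σa-enum = record
        { into = prepend-All (All.tabulate (∈⇒∈We ∘ there)) (λ _ → ∈⇒∈We (here refl))
        ; onto = λ x∈We → hit (proj₁ (proj₂ finite) x∈We)
        }
        where
        hit : ∀ {x} → x ∈ₗ a ∷ σ → ∃[ t ] prepend σ (const a) t ≡ x
        hit (here refl) = length σ + 0 , prepend-length+ σ (const a) 0
        hit (there x∈σ) with t , _ , eq ← ∈-applyUpTo⁻ (prepend σ (const a))
          (subst (_ ∈ₗ_) (sym (trans (applyUpTo-prepend σ (const a) 0) (++-identityʳ σ))) x∈σ)
          = t , sym eq

      a∈K : a ∈ K
      a∈K = em⇒dne em λ a∉K → contradictory a∉K
        (eventual-value-correct σ (const a) (∈⇒∈We (here refl)) σa-enum λ s →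
          -- A value other than i at any s would make the search halt on a and so put a into K.
          em⇒dne em λ M≢i → a∉K (proj₂ (proj₂ change-index)
            (findChange-halts (proj₂ M-computable) σ i a s M≢i)))
        where
        contradictory : a ∉ K → ¬ Eᶜᵉ K i e
        contradictory a∉K (inj₁ (_ , We⊆K)) = a∉K (We⊆K (∈⇒∈We (here refl)))
        contradictory _   (inj₂ (Wi⊈K , _)) = Wi⊈K Wi⊆K

theorem6p4 : ExcludedMiddle 0ℓ → (𝓔 : AcceptableEnumeration) →
    let open AcceptableEnumeration 𝓔 in
    Universal 𝓔 (Eᶜᵉ K) × ¬ ComputablyUniversal 𝓔 (Eᶜᵉ K)
theorem6p4 em 𝓔 = universal-K 𝓔 em , λ computably-universal →
  let M , M-computable , learns = computably-universal (allNonempty 𝓔)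
  in not-computably-learned 𝓔 M-computable learns em
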